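{- Let $p$ be an odd prime and let $k$ be an integer with $2\le k\le p-1$. Let $k^{ -1}$ denote the least non-negative integer congruent to the inverse of $k$ modulo $p$, and let $K=\min\{k,k^{ -1}\}$. Let $\phi$ be the orthomorphism of $\mathbb{Z}_p$ given by $\phi(x)=kx$, and let $\phi'$ be any orthomorphism of $\mathbb{Z}_p$ with $\phi'\neq\phi$. Then the number of $x\in\mathbb{Z}_p$ with $\phi(x)\neq\phi'(x)$ is at least $\log_K(p)+1$.
   Context: An orthomorphism of the cyclic group $\mathbb{Z}_p$ is a permutation $\psi$ of $\mathbb{Z}_p$ such that the map $x\mapsto \psi(x)-x$ (computed modulo $p$) is also a permutation of $\mathbb{Z}_p$. The distance between two orthomorphisms is the number of $x$ at which they differ. -}

module Defs where

open import Data.Fin using (Fin; toℕ)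
open import Data.Fin.Properties using (_≟_)
open import Data.List using (allFin; filter; length)
open import Data.Nat using (ℕ; NonZero; _+_; _*_; _∸_; _^_; _≤_)
open import Data.Nat.DivMod using (_%_; _mod_)
open import Data.Product using (_×_)
open import Function.Definitions using (Bijective)
open import Relation.Binary.PropositionalEquality using (_≡_)
open import Relation.Nullary.Decidable using (¬?)

-- ℤ_p is represented by Fin p, i.e. by least non-negative residues.

-- The truncated subtraction p ∸ toℕ y is exact because toℕ y < p.
sub : ∀ {p} .{{_ : NonZero p}} → Fin p → Fin p → Fin p
sub {p} x y = (toℕ x + (p ∸ toℕ y)) mod p

IsPermutation : ∀ {p} → (Fin p → Fin p) → Set
IsPermutation = Bijective _≡_ _≡_

IsOrthomorphism : ∀ {p} .{{_ : NonZero p}} → (Fin p → Fin p) → Set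
IsOrthomorphism ψ = IsPermutation ψ × IsPermutation (λ x → sub (ψ x) x)

linear : ∀ p .{{_ : NonZero p}} → ℕ → Fin p → Fin p
linear p k x = (k * toℕ x) mod p

distance : ∀ {p} → (Fin p → Fin p) → (Fin p → Fin p) → ℕ
distance {p} ψ χ = length (filter (λ x → ¬? (ψ x ≟ χ x)) (allFin p))

IsInverseMod : ∀ p .{{_ : NonZero p}} → ℕ → ℕ → Set
IsInverseMod p k j = (k * j) % p ≡ 1 % p

IsLeastInverseMod : ∀ p .{{_ : NonZero p}} → ℕ → ℕ → Set
IsLeastInverseMod p k j =
  IsInverseMod p k j × (∀ i → IsInverseMod p k i → j ≤ i)

-- The real inequality log_K(n) + 1 ≤ d, for K ≥ 2, n ≥ 1 and natural d.
-- Since t ↦ K^t is strictly increasing on the reals and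
-- K^(log_K(n) + 1) = K n, it is the inequality K n ≤ K^d.
log[_]_+1≤_ : ℕ → ℕ → ℕ → Set
log[ K ] n +1≤ d = K * n ≤ K ^ d

{-# OPTIONS --safe #-}
-- Write φ′(x) = k σ(x) and φ′(x) − x = (k − 1) τ(x) with permutations σ, τ, so
-- that k σ(x) = x + (k − 1) τ(x).  With (α, β) = (σ⁻¹, τ σ⁻¹) and m = k, or with
-- (α, β) = (σ, τ) and m = k⁻¹, this reads m x = α(x) + (m − 1) β(x) mod p, and
-- both α and β move only the d points where φ and φ′ differ.
--
-- Read the relation as a chip-firing rule: a vertex holding m chips sends one to
-- α(x) and m − 1 to β(x).  Firing preserves Σ c(x) (x − r) mod p.  Fix a moved
-- point r as a sink and start with a pile of s chips at α(r).  Since α and β are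
-- permutations, every vertex reached from r can also reach r, hence firing
-- terminates (a hitting time is a strictly decreasing potential).  The final
-- configuration has fewer than m chips at each of the other d − 1 moved points
-- and determines s (α(r) − r), hence s, mod p; therefore p ≤ m^(d − 1).
module Submission where

open import Defs
open import Data.Fin using (Fin; zero; suc; toℕ; funToFin; finToFun)
open import Data.Fin.Properties using (_≟_; all?; ¬∀⟶∃¬; pigeonhole; injective⇒≤; finToFun-funToFin;
  toℕ-fromℕ<; toℕ<n; toℕ≤n; toℕ-injective)
open import Data.Fin.Subset using (Subset; _∈_; _∉_; _⊆_; _∪_; ⁅_⁆; ∣_∣)
open import Data.Fin.Subset.Properties using (_∈?_; ∣p∣≤n; p⊂q⇒∣p∣<∣q∣; p⊆p∪q; q⊆p∪q; x∈p∪q⁻; x∈⁅x⁆; x∈⁅y⁆⇒x≡y)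
open import Data.List as List using (List; []; _∷_; allFin; filter; length)
open import Data.List.Membership.Propositional using () renaming (_∈_ to _∈ˡ_)
open import Data.List.Membership.Propositional.Properties using (∈-filter⁺; ∈-filter⁻; ∈-allFin)
open import Data.List.Relation.Unary.Any using (here; there; index)
open import Data.List.Relation.Unary.Any.Properties using (lookup-index)
open import Data.Nat using (ℕ; zero; suc; _+_; _*_; _∸_; _^_; _≤_; _<_; _<?_; _⊓_; NonZero; z≤n; s≤s)
open import Data.Nat.DivMod using (_/_; _%_; _mod_; m≡m%n+[m/n]*n; m%n<n; m%n%n≡m%n; m<n⇒m%n≡m; n%n≡0; %-distribˡ-*)
open import Data.Nat.Divisibility using (_∣_; >⇒∤)
open import Data.Nat.GeneralisedArithmetic using (iterate)
open import Data.Nat.Induction using (<-wellFounded; Acc; acc)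
open import Data.Nat.Primality using (Prime; euclidsLemma)
open import Data.Nat.Properties hiding (_≟_)
open import Data.Nat.Tactic.RingSolver using (solve-∀)
open import Algebra.Properties.Monoid.Sum +-0-monoid using (sum; sum-cong-≗)
open import Data.Product using (∃; _×_; _,_; proj₁; proj₂)
open import Data.Sum as Sum using (_⊎_; inj₁; inj₂)
open import Data.Vec using (tabulate; lookup)
open import Data.Vec.Functional using (updateAt)
open import Data.Vec.Functional.Properties using (updateAt-minimal)
open import Data.Vec.Properties using (lookup∘tabulate; []=⇒lookup; lookup⇒[]=)
open import Function using (_∘_; Injective)
open import Relation.Binary.PropositionalEquality
open import Relation.Nullary using (¬_; yes; no; contradiction)
open import Relation.Nullary.Decidable using (¬?; _→-dec_; decidable-stable)

-- Chip configurations paired with vertex weights.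

infix 8 ⟨_,_⟩

⟨_,_⟩ : ∀ {n} → (Fin n → ℕ) → (Fin n → ℕ) → ℕ
⟨ c , w ⟩ = sum (λ x → c x * w x)

weight-add : ∀ {n} (c w : Fin n → ℕ) y a →
  ⟨ updateAt c y (a +_) , w ⟩ ≡ a * w y + ⟨ c , w ⟩
weight-add c w zero a =
  trans (cong (_+ ⟨ c ∘ suc , w ∘ suc ⟩) (*-distribʳ-+ (w zero) a (c zero)))
        (+-assoc (a * w zero) _ _)
weight-add c w (suc y) a =
  trans (cong (c zero * w zero +_) (weight-add (c ∘ suc) (w ∘ suc) y a))
        (swap (c zero * w zero) (a * w (suc y)) _)
  where
  swap : ∀ u v t → u + (v + t) ≡ v + (u + t)
  swap = solve-∀

-- Putting the `a` chips back restores `c`, so this is `weight-add` read backwards; `a ≤ c y` makes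
-- the truncated subtraction exact.
weight-remove : ∀ {n} (c w : Fin n → ℕ) y {a} → a ≤ c y →
  a * w y + ⟨ updateAt c y (_∸ a) , w ⟩ ≡ ⟨ c , w ⟩
weight-remove c w y {a} a≤cy =
  trans (sym (weight-add _ w y a)) (sum-cong-≗ (λ x → cong (_* w x) (restore c y a≤cy x)))
  where
  restore : ∀ {n} (c : Fin n → ℕ) y {a} → a ≤ c y →
    updateAt (updateAt c y (_∸ a)) y (a +_) ≗ c
  restore c zero a≤ zero = m+[n∸m]≡n a≤
  restore c zero a≤ (suc x) = refl
  restore c (suc y) a≤ zero = refl
  restore c (suc y) a≤ (suc x) = restore (c ∘ suc) y a≤ x

weight-zero : ∀ {n} (w : Fin n → ℕ) → ⟨ (λ _ → 0) , w ⟩ ≡ 0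
weight-zero {zero} w = refl
weight-zero {suc n} w = weight-zero (w ∘ suc)

-- Ascending chains of finite sets and orbits of injective self-maps.

preimage : ∀ {m n} → (Fin m → Fin n) → Subset n → Subset m
preimage f q = tabulate (lookup q ∘ f)

∈-preimage⁺ : ∀ {m n} (f : Fin m → Fin n) {q x} → f x ∈ q → x ∈ preimage f q
∈-preimage⁺ f {q} {x} fx∈q =
  lookup⇒[]= x _ (trans (lookup∘tabulate _ x) ([]=⇒lookup fx∈q))

∈-preimage⁻ : ∀ {m n} (f : Fin m → Fin n) {q x} → x ∈ preimage f q → f x ∈ q
∈-preimage⁻ f {q} {x} x∈ =
  lookup⇒[]= (f x) q (trans (sym (lookup∘tabulate _ x)) ([]=⇒lookup x∈))

-- Each strict inclusion raises the cardinality, which is at most `n`. The search keeps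
-- `n ≤ fuel + ∣ S i ∣`, so with no fuel left `S i` is already full and cannot grow.
ascending-stabilises : ∀ {n} (S : ℕ → Subset n) → (∀ i → S i ⊆ S (suc i)) →
  ∃ λ i → S (suc i) ⊆ S i
ascending-stabilises {n} S S⊆ = go n 0 (m≤m+n n _)
  where
  go : ∀ fuel i → n ≤ fuel + ∣ S i ∣ → ∃ λ j → S (suc j) ⊆ S j
  go fuel i n≤ with all? (λ x → x ∈? S (suc i) →-dec x ∈? S i)
  ... | yes stable = i , λ {x} → stable x
  ... | no unstable
    with x , x∉ ← ¬∀⟶∃¬ n _ (λ x → x ∈? S (suc i) →-dec x ∈? S i) unstable
    with x ∈? S (suc i)
  ...   | no x∉S′ = contradiction (λ x∈S′ → contradiction x∈S′ x∉S′) x∉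
  ...   | yes x∈S′ = step fuel n≤
    where
    grows : ∣ S i ∣ < ∣ S (suc i) ∣
    grows = p⊂q⇒∣p∣<∣q∣ (S⊆ i , x , x∈S′ , λ x∈S → x∉ (λ _ → x∈S))
    step : ∀ fuel → n ≤ fuel + ∣ S i ∣ → ∃ λ j → S (suc j) ⊆ S j
    step zero n≤ = contradiction (≤-trans grows (∣p∣≤n (S (suc i)))) (≤⇒≯ n≤)
    step (suc fuel) n≤ = go fuel (suc i)
      (≤-trans n≤ (≤-trans (≤-reflexive (sym (+-suc fuel _))) (+-monoʳ-≤ fuel grows)))

iterate-suc : ∀ {A : Set} (f : A → A) x n → iterate f (f x) n ≡ f (iterate f x n)
iterate-suc f x zero = refl
iterate-suc f x (suc n) = iterate-suc f (f x) n

-- Two of the first `n + 1` iterates of `x` coincide by pigeonhole; injectivity strips applications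
-- of `f` from both until the earlier one is `x` itself.
returns : ∀ {n} {f : Fin n → Fin n} → Injective _≡_ _≡_ f → ∀ x →
  ∃ λ s → iterate f (f x) s ≡ x
returns {n} {f} f-inj x
  with i , j , i<j , eq ← pigeonhole (n<1+n n) (λ i → iterate f x (toℕ i))
  = unwind (toℕ i) (toℕ j) i<j eq
  where
  unwind : ∀ i j → i < j → iterate f x i ≡ iterate f x j → ∃ λ s → iterate f (f x) s ≡ x
  unwind zero (suc j) _ eq = j , sym eq
  unwind (suc i) (suc j) (s≤s i<j) eq =
    unwind i j i<j (f-inj (trans (sym (iterate-suc f x i)) (trans eq (iterate-suc f x j))))

injective⇒preimage : ∀ {n} {f : Fin n → Fin n} → Injective _≡_ _≡_ f → ∀ y → ∃ λ x → f x ≡ y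
injective⇒preimage {f = f} f-inj y with s , eq ← returns f-inj y =
  iterate f y s , trans (sym (iterate-suc f y s)) eq

-- The orbit of `f x` comes back to `x`, which lies in `C`; closure under preimages then pulls
-- membership back along the orbit to `f x`. Thus the set of vertices that can reach the sink cannot
-- be left by firing.
injective-forward-closed : ∀ {n} {f : Fin n → Fin n} → Injective _≡_ _≡_ f →
  ∀ {C : Subset n} → (∀ {x} → f x ∈ C → x ∈ C) → ∀ {x} → x ∈ C → f x ∈ C
injective-forward-closed {f = f} f-inj {C} back {x} x∈C
  with s , eq ← returns f-inj x = pull s (subst (_∈ C) (sym eq) x∈C)
  where
  pull : ∀ s {y} → iterate f y s ∈ C → y ∈ C
  pull zero y∈ = y∈
  pull (suc s) y∈ = back (pull s y∈)

-- Chip firing with sink `r`: reachability, a decreasing potential, termination.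

module Chips {n} (l : ℕ) (α β : Fin n → Fin n)
  (α-inj : Injective _≡_ _≡_ α) (β-inj : Injective _≡_ _≡_ β) (r : Fin n) where

  private
    m : ℕ
    m = suc l

  -- The points from which a walk of at most `i` steps, each along `α` or `β`, leads to `r`.
  within : ℕ → Subset n
  within zero = ⁅ r ⁆
  within (suc i) = ⁅ r ⁆ ∪ (preimage α (within i) ∪ preimage β (within i))

  within-root : ∀ i → r ∈ within i
  within-root zero = x∈⁅x⁆ r
  within-root (suc i) = p⊆p∪q _ (x∈⁅x⁆ r)

  within-α : ∀ i {x} → α x ∈ within i → x ∈ within (suc i)
  within-α i αx∈ = q⊆p∪q ⁅ r ⁆ _ (p⊆p∪q _ (∈-preimage⁺ α αx∈))

  within-β : ∀ i {x} → β x ∈ within i → x ∈ within (suc i)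
  within-β i βx∈ = q⊆p∪q ⁅ r ⁆ _ (q⊆p∪q (preimage α (within i)) _ (∈-preimage⁺ β βx∈))

  within⁻ : ∀ i {x} → x ≢ r → x ∈ within (suc i) → α x ∈ within i ⊎ β x ∈ within i
  within⁻ i x≢r x∈ with x∈p∪q⁻ ⁅ r ⁆ _ x∈
  ... | inj₁ x∈r = contradiction (x∈⁅y⁆⇒x≡y r x∈r) x≢r
  ... | inj₂ x∈′ = Sum.map (∈-preimage⁻ α) (∈-preimage⁻ β)
                     (x∈p∪q⁻ (preimage α (within i)) _ x∈′)

  within-suc : ∀ i → within i ⊆ within (suc i)
  within-suc i {x} x∈ with x ≟ r
  ... | yes refl = within-root (suc i)
  within-suc zero x∈ | no x≢r = contradiction (x∈⁅y⁆⇒x≡y r x∈) x≢r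
  within-suc (suc i) x∈ | no x≢r with within⁻ i x≢r x∈
  ... | inj₁ αx∈ = within-α (suc i) (within-suc i αx∈)
  ... | inj₂ βx∈ = within-β (suc i) (within-suc i βx∈)

  -- A walk from a common fixed point never leaves it. Hence, apart from `r`, only moved points can
  -- reach the sink, which limits the number of free chip counts.
  within-fixed : ∀ i {x} → α x ≡ x → β x ≡ x → x ∈ within i → x ≡ r
  within-fixed zero _ _ x∈ = x∈⁅y⁆⇒x≡y r x∈
  within-fixed (suc i) {x} αx≡x βx≡x x∈ with x ≟ r
  ... | yes x≡r = x≡r
  ... | no x≢r with within⁻ i x≢r x∈
  ...   | inj₁ αx∈ = within-fixed i αx≡x βx≡x (subst (_∈ within i) αx≡x αx∈)
  ...   | inj₂ βx∈ = within-fixed i αx≡x βx≡x (subst (_∈ within i) βx≡x βx∈)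

  private
    stable-within = ascending-stabilises within within-suc
    -- The same `depth` also caps the hitting time in `potential`: every vertex of the component
    -- reaches `r` within `depth` steps, which makes the growth estimate strict there.
    depth = proj₁ stable-within

  component : Subset n
  component = within depth

  component-α : ∀ {x} → x ∈ component → α x ∈ component
  component-α = injective-forward-closed α-inj (proj₂ stable-within ∘ within-α depth)

  component-β : ∀ {x} → x ∈ component → β x ∈ component
  component-β = injective-forward-closed β-inj (proj₂ stable-within ∘ within-β depth)

  r∈component : r ∈ component
  r∈component = within-root depth

  component-fixed : ∀ {x} → α x ≡ x → β x ≡ x → x ∈ component → x ≡ r
  component-fixed = within-fixed depth

  -- m^(i-1) times the expected time, capped at i, at which the random walk
  -- moving to α x with probability 1/m and to β x with probability l/m hits r.
  potential : ℕ → Fin n → ℕ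
  potential zero x = 0
  potential (suc i) x with x ≟ r
  ... | yes _ = 0
  ... | no _ = m ^ i + (potential i (α x) + l * potential i (β x))

  potential-step : ∀ i {x} → x ≢ r →
    potential (suc i) x ≡ m ^ i + (potential i (α x) + l * potential i (β x))
  potential-step i {x} x≢r with x ≟ r
  ... | yes x≡r = contradiction x≡r x≢r
  ... | no _ = refl

  private
    regroup : ∀ l e a b →
      suc l * e + ((suc l * a + e) + l * (suc l * b + e)) ≡ suc l * (e + (a + l * b)) + suc l * e
    regroup = solve-∀

    growth-step : ∀ i {x} → x ≢ r →
      m ^ suc i + ((m * potential i (α x) + m ^ i) + l * (m * potential i (β x) + m ^ i)) ≡
      m * potential (suc i) x + m ^ suc i
    growth-step i {x} x≢r =
      trans (regroup l (m ^ i) (potential i (α x)) (potential i (β x)))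
            (cong (λ h → m * h + m ^ suc i) (sym (potential-step i x≢r)))

  -- Raising the cap on the hitting time by one raises its expectation by at most one; scaling by
  -- `m ^ i` clears the denominators.
  potential-growth : ∀ i x → potential (suc i) x ≤ m * potential i x + m ^ i
  potential-growth zero x with x ≟ r
  ... | yes _ = z≤n
  ... | no _ rewrite *-zeroʳ l = ≤-refl
  potential-growth (suc i) x with x ≟ r
  ... | yes _ = z≤n
  ... | no _ = ≤-trans
    (+-monoʳ-≤ (m ^ suc i) (+-mono-≤ (potential-growth i (α x)) (*-monoʳ-≤ l (potential-growth i (β x)))))
    (≤-reflexive (regroup l (m ^ i) (potential i (α x)) (potential i (β x))))

  -- Strictness at r propagates backwards along walks to r.
  potential-growth-strict : .{{NonZero l}} → ∀ i {x} → x ∈ within i →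
    potential (suc i) x < m * potential i x + m ^ i
  potential-growth-strict i {x} x∈ with x ≟ r
  ... | yes _ = ≤-trans (m^n>0 m i) (m≤n+m (m ^ i) _)
  potential-growth-strict zero x∈ | no x≢r = contradiction (x∈⁅y⁆⇒x≡y r x∈) x≢r
  potential-growth-strict (suc i) {x} x∈ | no x≢r with within⁻ i x≢r x∈
  ... | inj₁ αx∈ = <-≤-trans
    (+-monoʳ-< (m ^ suc i) (+-mono-<-≤ (potential-growth-strict i αx∈) (*-monoʳ-≤ l (potential-growth i (β x)))))
    (≤-reflexive (growth-step i x≢r))
  ... | inj₂ βx∈ = <-≤-trans
    (+-monoʳ-< (m ^ suc i) (+-mono-≤-< (potential-growth i (α x)) (*-monoʳ-< l (potential-growth-strict i βx∈))))
    (≤-reflexive (growth-step i x≢r))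

  -- All chips are removed before any is added, so `_∸ m` is exact whenever `m ≤ c x`, even if `x`,
  -- `α x` and `β x` coincide.
  fire : Fin n → (Fin n → ℕ) → (Fin n → ℕ)
  fire x c = updateAt (updateAt (updateAt c x (_∸ m)) (β x) (l +_)) (α x) (1 +_)

  -- The lost weight stands on the left to avoid subtraction. The weight `w` is arbitrary: the
  -- potential gives termination, residues give the invariant.
  fire-weight : ∀ x c w → m ≤ c x →
    m * w x + ⟨ fire x c , w ⟩ ≡ (w (α x) + l * w (β x)) + ⟨ c , w ⟩
  fire-weight x c w m≤cx = begin
    m * w x + ⟨ fire x c , w ⟩
      ≡⟨ cong (m * w x +_) (trans (weight-add _ w (α x) 1)
           (cong (1 * w (α x) +_) (weight-add _ w (β x) l))) ⟩
    m * w x + (1 * w (α x) + (l * w (β x) + ⟨ updateAt c x (_∸ m) , w ⟩))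
      ≡⟨ rearrange (m * w x) (w (α x)) (l * w (β x)) _ ⟩
    (w (α x) + l * w (β x)) + (m * w x + ⟨ updateAt c x (_∸ m) , w ⟩)
      ≡⟨ cong ((w (α x) + l * w (β x)) +_) (weight-remove c w x m≤cx) ⟩
    (w (α x) + l * w (β x)) + ⟨ c , w ⟩ ∎
    where
    open ≡-Reasoning
    rearrange : ∀ a b d e → a + (1 * b + (d + e)) ≡ (b + d) + (a + e)
    rearrange = solve-∀

  -- Confines the chips to the component, where the potential is strictly superharmonic off `r`.
  Supported : (Fin n → ℕ) → Set
  Supported c = ∀ {y} → y ∉ component → c y ≡ 0

  supported-member : ∀ {c x} → Supported c → m ≤ c x → x ∈ component
  supported-member {c} {x} supp m≤cx with x ∈? component
  ... | yes x∈ = x∈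
  ... | no x∉ = contradiction (subst (m ≤_) (supp x∉) m≤cx) λ ()

  fire-supported : ∀ {x c} → m ≤ c x → Supported c → Supported (fire x c)
  fire-supported {x} {c} m≤cx supp {y} y∉ =
    trans (updateAt-minimal y (α x) _ λ { refl → y∉ (component-α x∈) })
    (trans (updateAt-minimal y (β x) _ λ { refl → y∉ (component-β x∈) })
    (trans (updateAt-minimal y x _ λ { refl → y∉ x∈ }) (supp y∉)))
    where
    x∈ = supported-member supp m≤cx

  fire-decreases : .{{NonZero l}} → ∀ {x c} → x ≢ r → m ≤ c x → Supported c →
    ⟨ fire x c , potential depth ⟩ < ⟨ c , potential depth ⟩
  fire-decreases {x} {c} x≢r m≤cx supp =
    +-cancelˡ-< (h (α x) + l * h (β x)) _ _
      (subst (h (α x) + l * h (β x) + ⟨ fire x c , h ⟩ <_) (fire-weight x c h m≤cx)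
        (+-monoˡ-< _ superharmonic))
    where
    h = potential depth
    superharmonic : h (α x) + l * h (β x) < m * h x
    -- The recursion writes `potential (suc depth) x` as `m ^ depth` plus the left side; strict
    -- growth bounds it by `m * h x + m ^ depth`, and `m ^ depth` cancels.
    superharmonic = +-cancelˡ-< (m ^ depth) _ _
      (subst₂ _<_ (potential-step depth x≢r) (+-comm (m * h x) (m ^ depth))
        (potential-growth-strict depth (supported-member supp m≤cx)))

  Stable : (Fin n → ℕ) → Set
  Stable c = ∀ x → x ≢ r → c x < m

  -- Overfull vertices other than `r` are fired while any exist; the weighted potential drops each
  -- time, so the recursion is well founded. `P` carries a firing invariant along.
  stabilise : .{{NonZero l}} → (P : (Fin n → ℕ) → Set) →
    (∀ {x c} → m ≤ c x → P c → P (fire x c)) →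
    ∀ c → Supported c → P c → ∃ λ c′ → Stable c′ × Supported c′ × P c′
  stabilise P P-fire c = go c (<-wellFounded _)
    where
    go : ∀ c → Acc _<_ ⟨ c , potential depth ⟩ → Supported c → P c →
      ∃ λ c′ → Stable c′ × Supported c′ × P c′
    go c (acc rs) supp Pc with all? (λ x → ¬? (x ≟ r) →-dec c x <? m)
    ... | yes stable = c , stable , supp , Pc
    ... | no unstable
      with x , bad ← ¬∀⟶∃¬ n _ (λ x → ¬? (x ≟ r) →-dec c x <? m) unstable
      with x ≟ r | c x <? m
    ...   | yes x≡r | _ = contradiction (λ x≢r → contradiction x≡r x≢r) bad
    ...   | no _ | yes cx<m = contradiction (λ _ → cx<m) bad
    ...   | no x≢r | no cx≮m =
      go (fire x c) (rs (fire-decreases x≢r m≤cx supp)) (fire-supported m≤cx supp) (P-fire m≤cx Pc)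
      where m≤cx = ≮⇒≥ cx≮m

-- Congruences of integers modulo `p`.

open import Data.Integer as ℤ using (ℤ; +_; 1ℤ)
import Data.Integer.Divisibility.Signed as ℤ∣
import Data.Integer.Properties as ℤ
import Data.Integer.Tactic.RingSolver as ℤ

module Residues (p : ℕ) .{{_ : NonZero p}} where

  infix 4 _≈_
  -- A record rather than a plain synonym, so that `a` and `b` can be inferred from the type.
  record _≈_ (a b : ℤ) : Set where
    constructor congruent
    field difference : + p ℤ∣.∣ a ℤ.- b
  open _≈_

  ι : Fin p → ℤ
  ι x = + toℕ x

  ≈-sym : ∀ {a b} → a ≈ b → b ≈ a
  ≈-sym {a} {b} (congruent h) = congruent (subst (+ p ℤ∣.∣_) (identity a b) (ℤ∣.∣m⇒∣-m h))
    where
    identity : ∀ a b → ℤ.- (a ℤ.- b) ≡ b ℤ.- a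
    identity = ℤ.solve-∀

  ≈-trans : ∀ {a b c} → a ≈ b → b ≈ c → a ≈ c
  ≈-trans {a} {b} {c} (congruent h) (congruent h′) =
    congruent (subst (+ p ℤ∣.∣_) (identity a b c) (ℤ∣.∣m∣n⇒∣m+n h h′))
    where
    identity : ∀ a b c → (a ℤ.- b) ℤ.+ (b ℤ.- c) ≡ a ℤ.- c
    identity = ℤ.solve-∀

  *-congˡ : ∀ a {b c} → b ≈ c → a ℤ.* b ≈ a ℤ.* c
  *-congˡ a {b} {c} (congruent h) = congruent (subst (+ p ℤ∣.∣_) (identity a b c) (ℤ∣.∣n⇒∣m*n a h))
    where
    identity : ∀ a b c → a ℤ.* (b ℤ.- c) ≡ a ℤ.* b ℤ.- a ℤ.* c
    identity = ℤ.solve-∀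

  ≈-reflexive : ∀ {a b} → a ≡ b → a ≈ b
  ≈-reflexive {a} refl = congruent (subst (+ p ℤ∣.∣_) (sym (ℤ.+-inverseʳ a)) (ℤ∣.divides (+ 0) refl))

  %-≈ : ∀ a → + (a % p) ≈ + a
  %-≈ a = ≈-sym (congruent (ℤ∣.divides (+ (a / p)) (begin
    + a ℤ.- + (a % p)                           ≡⟨ cong (λ b → + b ℤ.- + (a % p)) (m≡m%n+[m/n]*n a p) ⟩
    + (a % p) ℤ.+ + (a / p * p) ℤ.- + (a % p)   ≡⟨ identity (+ (a % p)) _ ⟩
    + (a / p * p)                               ≡⟨ ℤ.pos-* (a / p) p ⟩
    + (a / p) ℤ.* + p                           ∎)))
    where
    open ≡-Reasoning
    identity : ∀ r q → r ℤ.+ q ℤ.- r ≡ q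
    identity = ℤ.solve-∀

  mod-≈ : ∀ a → ι (a mod p) ≈ + a
  mod-≈ a = subst (_≈ + a) (cong +_ (sym (toℕ-fromℕ< (m%n<n a p)))) (%-≈ a)

  linear-≈ : ∀ k x → ι (linear p k x) ≈ + k ℤ.* ι x
  linear-≈ k x = subst (ι (linear p k x) ≈_) (ℤ.pos-* k (toℕ x)) (mod-≈ (k * toℕ x))

  sub-≈ : ∀ x y → ι (sub x y) ≈ ι x ℤ.- ι y
  sub-≈ x y = congruent (subst (+ p ℤ∣.∣_) eq
    (ℤ∣.∣m∣n⇒∣m+n (difference (mod-≈ (toℕ x + (p ∸ toℕ y)))) ℤ∣.∣-refl))
    where
    open ≡-Reasoning
    identity : ∀ s x y p → (s ℤ.- (x ℤ.+ (p ℤ.- y))) ℤ.+ p ≡ s ℤ.- (x ℤ.- y)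
    identity = ℤ.solve-∀
    eq : (ι (sub x y) ℤ.- + (toℕ x + (p ∸ toℕ y))) ℤ.+ + p ≡ ι (sub x y) ℤ.- (ι x ℤ.- ι y)
    eq = begin
      (ι (sub x y) ℤ.- (ι x ℤ.+ + (p ∸ toℕ y))) ℤ.+ + p
        ≡⟨ cong (λ d → (ι (sub x y) ℤ.- (ι x ℤ.+ d)) ℤ.+ + p)
             (trans (sym (ℤ.⊖-≥ (toℕ≤n y))) (sym (ℤ.m-n≡m⊖n p (toℕ y)))) ⟩
      (ι (sub x y) ℤ.- (ι x ℤ.+ (+ p ℤ.- ι y))) ℤ.+ + p
        ≡⟨ identity (ι (sub x y)) (ι x) (ι y) (+ p) ⟩
      ι (sub x y) ℤ.- (ι x ℤ.- ι y) ∎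

  sub-self : ∀ x → toℕ (sub x x) ≡ 0
  sub-self x = trans (toℕ-fromℕ< _) (trans (cong (_% p) (m+[n∸m]≡n (toℕ≤n x))) (n%n≡0 p))

  -- Two representatives differ by less than `p`, and the only such multiple of `p` is zero.
  ι-injective : ∀ {x y} → ι x ≈ ι y → x ≡ y
  ι-injective {x} {y} (congruent h) = toℕ-injective (ℤ.+-injective (ℤ.i-j≡0⇒i≡j (ι x) (ι y)
    (ℤ.∣i∣≡0⇒i≡0 (small (ℤ∣.∣⇒∣ᵤ h) bound))))
    where
    bound : ℤ.∣ ι x ℤ.- ι y ∣ < p
    bound = ≤-<-trans (≤-trans (≤-reflexive (cong ℤ.∣_∣ (ℤ.m-n≡m⊖n (toℕ x) (toℕ y)))) (ℤ.∣m⊝n∣≤m⊔n (toℕ x) (toℕ y)))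
                      (⊔-lub (toℕ<n x) (toℕ<n y))
    small : ∀ {d} → p ∣ d → d < p → d ≡ 0
    small {zero} _ _ = refl
    small {suc d} p∣d d<p = contradiction p∣d (>⇒∤ d<p)

  module _ (p-prime : Prime p) where

    -- Primality enters here, through Euclid's lemma.
    cancel : ∀ u {a b} → ¬ (p ∣ u) → + u ℤ.* a ≈ + u ℤ.* b → a ≈ b
    cancel u {a} {b} p∤u (congruent h)
      with euclidsLemma u ℤ.∣ a ℤ.- b ∣ p-prime
             (subst (p ∣_) (trans (cong ℤ.∣_∣ (identity (+ u) a b)) (ℤ.abs-* (+ u) (a ℤ.- b))) (ℤ∣.∣⇒∣ᵤ h))
      where
      identity : ∀ u a b → u ℤ.* a ℤ.- u ℤ.* b ≡ u ℤ.* (a ℤ.- b)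
      identity = ℤ.solve-∀
    ... | inj₁ p∣u = contradiction p∣u p∤u
    ... | inj₂ p∣d = congruent (ℤ∣.∣ᵤ⇒∣ p∣d)

    linear-injective : ∀ u → ¬ (p ∣ u) → Injective _≡_ _≡_ (linear p u)
    linear-injective u p∤u {x} {y} eq = ι-injective (cancel u p∤u
      (≈-trans (≈-sym (linear-≈ u x)) (subst (λ z → ι z ≈ + u ℤ.* ι y) (sym eq) (linear-≈ u y))))

    -- The counting bound for a pair of permutations satisfying the firing relation.

    module Firing (l : ℕ) .{{_ : NonZero l}} (p∤l : ¬ (p ∣ l)) (α β : Fin p → Fin p)
      (α-inj : Injective _≡_ _≡_ α) (β-inj : Injective _≡_ _≡_ β)
      (relation : ∀ y → + suc l ℤ.* ι y ≈ ι (α y) ℤ.+ + l ℤ.* ι (β y)) where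

      -- With `α x ≡ x` the relation reduces to `l x ≈ l (β x)`, and `l` cancels. So being moved by
      -- `α` is the only case to count.
      β-fixed : ∀ {x} → α x ≡ x → β x ≡ x
      β-fixed {x} αx≡x = ι-injective (≈-sym (cancel l p∤l (congruent (subst (+ p ℤ∣.∣_) eq (difference (relation x))))))
        where
        identity : ∀ l x b → (1ℤ ℤ.+ l) ℤ.* x ℤ.- (x ℤ.+ l ℤ.* b) ≡ l ℤ.* x ℤ.- l ℤ.* b
        identity = ℤ.solve-∀
        eq : + suc l ℤ.* ι x ℤ.- (ι (α x) ℤ.+ + l ℤ.* ι (β x)) ≡ + l ℤ.* ι x ℤ.- + l ℤ.* ι (β x)
        eq = trans (cong (λ z → + suc l ℤ.* ι x ℤ.- (ι z ℤ.+ + l ℤ.* ι (β x))) αx≡x)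
                   (identity (+ l) (ι x) (ι (β x)))

      module _ (r : Fin p) (αr≢r : α r ≢ r) where

        open Chips l α β α-inj β-inj r

        -- Measuring from `r` makes the sink weightless, so the unbounded number of chips there does
        -- not affect the total.
        w : Fin p → ℕ
        w x = toℕ (sub x r)

        -- Makes `w (α r)` cancellable, so different pile heights at `α r` have different residues.
        p∤wαr : ¬ (p ∣ w (α r))
        p∤wαr p∣w = αr≢r (ι-injective (congruent (subst (+ p ℤ∣.∣_) (identity (+ w (α r)) _)
          (ℤ∣.∣m∣n⇒∣m-n (ℤ∣.∣ᵤ⇒∣ {i = + w (α r)} p∣w) (difference (sub-≈ (α r) r))))))
          where
          identity : ∀ s a → s ℤ.- (s ℤ.- a) ≡ a
          identity = ℤ.solve-∀

        -- The coefficients on each side of `relation` add up to `suc l`, so it survives translation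
        -- by `r`.
        w-relation : ∀ x → + suc l ℤ.* + w x ≈ + w (α x) ℤ.+ + l ℤ.* + w (β x)
        w-relation x = congruent (subst (+ p ℤ∣.∣_)
          (identity (+ l) (ι x) (ι (α x)) (ι (β x)) (ι r) (+ w x) (+ w (α x)) (+ w (β x)))
          (ℤ∣.∣m∣n⇒∣m-n (ℤ∣.∣m∣n⇒∣m-n
            (ℤ∣.∣m∣n⇒∣m+n (difference (relation x)) (ℤ∣.∣n⇒∣m*n (+ suc l) (difference (sub-≈ x r))))
            (difference (sub-≈ (α x) r))) (ℤ∣.∣n⇒∣m*n (+ l) (difference (sub-≈ (β x) r)))))
          where
          identity : ∀ l x a b r wx wa wb →
            ((1ℤ ℤ.+ l) ℤ.* x ℤ.- (a ℤ.+ l ℤ.* b)) ℤ.+ (1ℤ ℤ.+ l) ℤ.* (wx ℤ.- (x ℤ.- r))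
              ℤ.- (wa ℤ.- (a ℤ.- r)) ℤ.- l ℤ.* (wb ℤ.- (b ℤ.- r))
            ≡ (1ℤ ℤ.+ l) ℤ.* wx ℤ.- (wa ℤ.+ l ℤ.* wb)
          identity = ℤ.solve-∀

        fire-≈ : ∀ {x c} → suc l ≤ c x → + ⟨ fire x c , w ⟩ ≈ + ⟨ c , w ⟩
        fire-≈ {x} {c} m≤cx = ≈-sym (congruent (subst (+ p ℤ∣.∣_) eq (difference (w-relation x))))
          where
          W W′ : ℤ
          W = + ⟨ c , w ⟩
          W′ = + ⟨ fire x c , w ⟩
          balance : + suc l ℤ.* + w x ℤ.+ W′ ≡ (+ w (α x) ℤ.+ + l ℤ.* + w (β x)) ℤ.+ W
          balance = trans (cong (ℤ._+ W′) (sym (ℤ.pos-* (suc l) (w x))))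
            (trans (cong +_ (fire-weight x c w m≤cx))
              (cong (λ z → + w (α x) ℤ.+ z ℤ.+ W) (ℤ.pos-* l (w (β x)))))
          identity : ∀ a b W W′ → (a ℤ.+ W′) ℤ.- (b ℤ.+ W) ℤ.+ (W ℤ.- W′) ≡ a ℤ.- b
          identity = ℤ.solve-∀
          eq : + suc l ℤ.* + w x ℤ.- (+ w (α x) ℤ.+ + l ℤ.* + w (β x)) ≡ W ℤ.- W′
          eq = trans (sym (identity (+ suc l ℤ.* + w x) (+ w (α x) ℤ.+ + l ℤ.* + w (β x)) W W′))
            (trans (cong (ℤ._+ (W ℤ.- W′)) (ℤ.i≡j⇒i-j≡0 balance)) (ℤ.+-identityˡ _))

        -- Firing preserves the residue of ⟨ c , w ⟩, so stabilising a pile at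
        -- α r of height s gives every residue in turn.
        stable-representative : ∀ (s : Fin p) →
          ∃ λ c → Stable c × Supported c × (+ ⟨ c , w ⟩ ≈ + w (α r) ℤ.* ι s)
        stable-representative s = stabilise (λ c → + ⟨ c , w ⟩ ≈ + w (α r) ℤ.* ι s)
          (λ {x} {c} m≤cx h → ≈-trans (fire-≈ m≤cx) h) start supp (≈-reflexive value)
          where
          start : Fin p → ℕ
          start = updateAt (λ _ → 0) (α r) (λ a → toℕ s + a)
          supp : Supported start
          supp {y} y∉ = updateAt-minimal y (α r) _ λ { refl → y∉ (component-α r∈component) }
          value : + ⟨ start , w ⟩ ≡ + w (α r) ℤ.* ι s
          value = trans (cong +_ (begin
            ⟨ start , w ⟩                          ≡⟨ weight-add (λ _ → 0) w (α r) (toℕ s) ⟩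
            toℕ s * w (α r) + ⟨ (λ _ → 0) , w ⟩    ≡⟨ cong (λ a → toℕ s * w (α r) + a) (weight-zero w) ⟩
            toℕ s * w (α r) + 0                    ≡⟨ +-identityʳ _ ⟩
            toℕ s * w (α r)                        ≡⟨ *-comm (toℕ s) _ ⟩
            w (α r) * toℕ s                        ∎)) (ℤ.pos-* (w (α r)) (toℕ s))
            where open ≡-Reasoning

        module _ (xs : List (Fin p)) (moved : ∀ {x} → α x ≢ x → x ≢ r → x ∈ˡ xs) where

          -- The sink has weight zero and vertices outside the component are empty. Any other vertex
          -- is moved, hence listed in `xs`, and its count is below `suc l`, so the residue is the
          -- count itself.
          stable-determined : ∀ {c c′} → Stable c → Stable c′ → Supported c → Supported c′ →
            (∀ i → c (List.lookup xs i) % suc l ≡ c′ (List.lookup xs i) % suc l) →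
            ⟨ c , w ⟩ ≡ ⟨ c′ , w ⟩
          stable-determined {c} {c′} st st′ supp supp′ agree = sum-cong-≗ pointwise
            where
            pointwise : ∀ x → c x * w x ≡ c′ x * w x
            pointwise x with x ≟ r
            ... | yes refl rewrite sub-self r | *-zeroʳ (c r) | *-zeroʳ (c′ r) = refl
            ... | no x≢r with x ∈? component
            ...   | no x∉ = cong (_* w x) (trans (supp x∉) (sym (supp′ x∉)))
            ...   | yes x∈ = cong (_* w x) (trans (sym (m<n⇒m%n≡m (st x x≢r)))
                      (trans agree-x (m<n⇒m%n≡m (st′ x x≢r))))
              where
              x∈xs : x ∈ˡ xs
              x∈xs = moved (λ αx≡x → x≢r (component-fixed αx≡x (β-fixed αx≡x) x∈)) x≢r
              agree-x : c x % suc l ≡ c′ x % suc l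
              agree-x = subst (λ y → c y % suc l ≡ c′ y % suc l)
                (sym (lookup-index x∈xs)) (agree (index x∈xs))

          -- Coding a pile height `s` by the digits of its stable configuration is injective: equal
          -- digits give equal weights, and `w (α r)` cancels from the resulting congruence.
          bound : p ≤ suc l ^ length xs
          bound = injective⇒≤ {f = funToFin ∘ digits} λ {s} {t} eq →
            let c , st , supp , value = stable-representative s
                c′ , st′ , supp′ , value′ = stable-representative t
                agree : ∀ i → c (List.lookup xs i) % suc l ≡ c′ (List.lookup xs i) % suc l
                agree i = trans (sym (toℕ-fromℕ< _)) (trans (cong toℕ (digits-≗ {s} {t} eq i)) (toℕ-fromℕ< _))
            in ι-injective (cancel (w (α r)) p∤wαr
                 (≈-trans (≈-sym value)
                   (subst (λ W → + W ≈ + w (α r) ℤ.* ι t)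
                     (sym (stable-determined st st′ supp supp′ agree)) value′)))
            where
            digits : Fin p → Fin (length xs) → Fin (suc l)
            digits s i = proj₁ (stable-representative s) (List.lookup xs i) mod suc l
            digits-≗ : ∀ {s t} → funToFin (digits s) ≡ funToFin (digits t) → digits s ≗ digits t
            digits-≗ {s} {t} eq i = trans (sym (finToFun-funToFin (digits s) i))
              (trans (cong (λ e → finToFun e i) eq) (finToFun-funToFin (digits t) i))

      distance-bound : (χ ψ : Fin p → Fin p) → (∀ {x} → χ x ≡ ψ x → α x ≡ x) →
        (∀ {x} → α x ≡ x → χ x ≡ ψ x) → ¬ (ψ ≗ χ) → log[ suc l ] p +1≤ distance χ ψ
      distance-bound χ ψ to from ψ≢χ
        -- Both membership facts are abstracted together with the list, so they refine to its shape
        -- when it is matched.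
        with filter (λ x → ¬? (χ x ≟ ψ x)) (allFin p)
           | (λ x → ∈-filter⁺ (λ x → ¬? (χ x ≟ ψ x)) (∈-allFin {p} x))
           | (λ {x} x∈ → proj₂ (∈-filter⁻ (λ x → ¬? (χ x ≟ ψ x)) {v = x} {xs = allFin p} x∈))
      ... | [] | complete | _ = contradiction
              (λ x → sym (decidable-stable (χ x ≟ ψ x) λ χx≢ψx → contradiction (complete x χx≢ψx) λ ())) ψ≢χ
      -- The first differing point becomes the sink and the others carry the digits; one further
      -- factor `suc l` accounts for the sink in the exponent.
      ... | r ∷ xs | complete | sound = *-monoʳ-≤ (suc l) (bound r (sound (here refl) ∘ from) xs moved)
        where
        moved : ∀ {x} → α x ≢ x → x ≢ r → x ∈ˡ xs
        moved {x} αx≢x x≢r with complete x (αx≢x ∘ to)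
        ... | here x≡r = contradiction x≡r x≢r
        ... | there x∈xs = x∈xs

    -- Firing relations obtained from an orthomorphism.

    module _ (l : ℕ) .{{_ : NonZero l}} (p∤l : ¬ (p ∣ l)) (p∤k : ¬ (p ∣ suc l))
      (φ′ : Fin p → Fin p) (ortho : IsOrthomorphism φ′) (φ′≢φ : ¬ (φ′ ≗ linear p (suc l))) where

      private
        k = suc l
        φ = linear p k

        φ′-inj : Injective _≡_ _≡_ φ′
        φ′-inj = proj₁ (proj₁ ortho)

        θ : Fin p → Fin p
        θ x = sub (φ′ x) x

        θ-inj : Injective _≡_ _≡_ θ
        θ-inj = proj₁ (proj₂ ortho)

        φ-inj : Injective _≡_ _≡_ φ
        φ-inj = linear-injective k p∤k

        φ′⁻¹ : Fin p → Fin p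
        φ′⁻¹ y = proj₁ (injective⇒preimage φ′-inj y)

        φ′∘φ′⁻¹ : ∀ y → φ′ (φ′⁻¹ y) ≡ y
        φ′∘φ′⁻¹ y = proj₂ (injective⇒preimage φ′-inj y)

        -- Division by `l = k − 1` modulo `p`; `divide ∘ θ` is the permutation `τ`.
        divide : Fin p → Fin p
        divide y = proj₁ (injective⇒preimage (linear-injective l p∤l) y)

        linear∘divide : ∀ y → linear p l (divide y) ≡ y
        linear∘divide y = proj₂ (injective⇒preimage (linear-injective l p∤l) y)

        divide-inj : Injective _≡_ _≡_ divide
        divide-inj {x} {y} eq =
          trans (sym (linear∘divide x)) (trans (cong (linear p l) eq) (linear∘divide y))

        divide-≈ : ∀ y → ι y ≈ + l ℤ.* ι (divide y)
        divide-≈ y = subst (λ z → ι z ≈ + l ℤ.* ι (divide y)) (linear∘divide y) (linear-≈ l (divide y))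

      -- At `a = σ⁻¹ y` one has `φ′ a ≡ φ y`, so `θ a ≈ l (β y)` becomes `k y ≈ a + l (β y)`.
      distance-multiplier : log[ k ] p +1≤ distance φ φ′
      distance-multiplier = distance-bound φ φ′ to from φ′≢φ
        where
        σ⁻¹ β : Fin p → Fin p
        σ⁻¹ y = φ′⁻¹ (φ y)
        β y = divide (θ (σ⁻¹ y))
        φ′∘σ⁻¹ : ∀ y → φ′ (σ⁻¹ y) ≡ φ y
        φ′∘σ⁻¹ y = φ′∘φ′⁻¹ (φ y)
        σ⁻¹-inj : Injective _≡_ _≡_ σ⁻¹
        σ⁻¹-inj {x} {y} eq = φ-inj (trans (sym (φ′∘σ⁻¹ x)) (trans (cong φ′ eq) (φ′∘σ⁻¹ y)))
        relation : ∀ y → + k ℤ.* ι y ≈ ι (σ⁻¹ y) ℤ.+ + l ℤ.* ι (β y)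
        relation y = congruent (subst (+ p ℤ∣.∣_)
          (identity (+ k ℤ.* ι y) (ι (φ y)) (ι (σ⁻¹ y)) (ι (θ (σ⁻¹ y))) (+ l ℤ.* ι (β y)))
          (ℤ∣.∣m∣n⇒∣m-n (ℤ∣.∣m∣n⇒∣m-n (difference (divide-≈ (θ (σ⁻¹ y))))
            (difference (subst (λ z → ι (θ (σ⁻¹ y)) ≈ ι z ℤ.- ι (σ⁻¹ y)) (φ′∘σ⁻¹ y)
              (sub-≈ (φ′ (σ⁻¹ y)) (σ⁻¹ y)))))
            (difference (linear-≈ k y))))
          where
          identity : ∀ ky φy a t lb →
            (t ℤ.- lb) ℤ.- (t ℤ.- (φy ℤ.- a)) ℤ.- (φy ℤ.- ky) ≡ ky ℤ.- (a ℤ.+ lb)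
          identity = ℤ.solve-∀
        open Firing l p∤l σ⁻¹ β σ⁻¹-inj (σ⁻¹-inj ∘ θ-inj ∘ divide-inj) relation
        to : ∀ {x} → φ x ≡ φ′ x → σ⁻¹ x ≡ x
        to {x} eq = φ′-inj (trans (φ′∘σ⁻¹ x) eq)
        from : ∀ {x} → σ⁻¹ x ≡ x → φ x ≡ φ′ x
        from {x} eq = trans (sym (φ′∘σ⁻¹ x)) (cong φ′ eq)

      -- Multiply `φ′ x ≈ x + l (β x)` by `j`. As `j k ≈ 1`, the product `j l` is congruent to
      -- `1 − j = − i`, which gives `j x ≈ σ x + i (β x)`.
      distance-inverse-multiplier : ∀ i .{{_ : NonZero i}} → ¬ (p ∣ i) → ¬ (p ∣ suc i) →
        + k ℤ.* + suc i ≈ 1ℤ → log[ suc i ] p +1≤ distance φ φ′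
      distance-inverse-multiplier i p∤i p∤j kj≈1 = distance-bound φ φ′ to from φ′≢φ
        where
        j = suc i
        σ β : Fin p → Fin p
        σ x = linear p j (φ′ x)
        β x = divide (θ x)
        relation : ∀ x → + j ℤ.* ι x ≈ ι (σ x) ℤ.+ + i ℤ.* ι (β x)
        relation x = congruent (subst (+ p ℤ∣.∣_)
          (identity (+ l) (+ i) (ι x) (ι (φ′ x)) (ι (σ x)) (ι (θ x)) (ι (β x)))
          (ℤ∣.∣m∣n⇒∣m-n (ℤ∣.∣m∣n⇒∣m-n (ℤ∣.∣m∣n⇒∣m-n
            (ℤ∣.∣n⇒∣m*n (+ j) (difference (sub-≈ (φ′ x) x)))
            (ℤ∣.∣n⇒∣m*n (+ j) (difference (divide-≈ (θ x)))))
            (difference (linear-≈ j (φ′ x))))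
            (ℤ∣.∣m⇒∣m*n (ι (β x)) (difference kj≈1))))
          where
          identity : ∀ l i x f a t b →
            (1ℤ ℤ.+ i) ℤ.* (t ℤ.- (f ℤ.- x)) ℤ.- (1ℤ ℤ.+ i) ℤ.* (t ℤ.- l ℤ.* b)
              ℤ.- (a ℤ.- (1ℤ ℤ.+ i) ℤ.* f) ℤ.- ((1ℤ ℤ.+ l) ℤ.* (1ℤ ℤ.+ i) ℤ.- 1ℤ) ℤ.* b
            ≡ (1ℤ ℤ.+ i) ℤ.* x ℤ.- (a ℤ.+ i ℤ.* b)
          identity = ℤ.solve-∀
        open Firing i p∤i σ β (φ′-inj ∘ linear-injective j p∤j) (θ-inj ∘ divide-inj) relation
        j∘φ : ∀ x → linear p j (φ x) ≡ x
        j∘φ x = ι-injective (≈-trans (linear-≈ j (φ x))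
          (≈-trans (*-congˡ (+ j) (linear-≈ k x)) (congruent (subst (+ p ℤ∣.∣_)
            (identity (+ k) (+ j) (ι x)) (ℤ∣.∣m⇒∣m*n (ι x) (difference kj≈1))))))
          where
          identity : ∀ k j x → (k ℤ.* j ℤ.- 1ℤ) ℤ.* x ≡ j ℤ.* (k ℤ.* x) ℤ.- x
          identity = ℤ.solve-∀
        to : ∀ {x} → φ x ≡ φ′ x → σ x ≡ x
        to {x} eq = trans (cong (linear p j) (sym eq)) (j∘φ x)
        from : ∀ {x} → σ x ≡ x → φ x ≡ φ′ x
        from {x} eq = linear-injective j p∤j (trans (j∘φ x) (sym eq))

  inverse-≈ : ∀ {k j} → IsInverseMod p k j → + k ℤ.* + j ≈ 1ℤ
  inverse-≈ {k} {j} eq = subst (_≈ 1ℤ) (ℤ.pos-* k j)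
    (≈-trans (≈-sym (%-≈ (k * j))) (subst (λ e → + e ≈ 1ℤ) (sym eq) (%-≈ 1)))

-- The size of the least inverse and the choice of multiplier.

least-inverse< : ∀ p .{{_ : NonZero p}} {k j} → IsLeastInverseMod p k j → j < p
-- Reducing an inverse modulo `p` gives another inverse, which the least one cannot exceed.
least-inverse< p {k} {j} (inv , least) = ≤-<-trans (least (j % p) reduced) (m%n<n j p)
  where
  reduced : IsInverseMod p k (j % p)
  reduced = trans (%-distribˡ-* k (j % p) p)
    (trans (cong (λ e → (k % p * e) % p) (m%n%n≡m%n j p)) (trans (sym (%-distribˡ-* k j p)) inv))

theorem6p1 : (p : ℕ) .{{_ : NonZero p}} → Prime p → ¬ (2 ∣ p) →
    (k : ℕ) → 2 ≤ k → k ≤ p ∸ 1 →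
    (k⁻¹ : ℕ) → IsLeastInverseMod p k k⁻¹ →
    (φ′ : Fin p → Fin p) → IsOrthomorphism φ′ → ¬ (φ′ ≗ linear p k) →
    log[ k ⊓ k⁻¹ ] p +1≤ distance (linear p k) φ′
theorem6p1 p p-prime _ k@(suc l@(suc _)) 2≤k k≤p-1 k⁻¹ least φ′ ortho φ′≢φ
  with k<p ← m≤pred[n]⇒suc[m]≤n k≤p-1
  with ⊓-sel k k⁻¹
... | inj₁ min≡k rewrite min≡k =
  Residues.distance-multiplier p p-prime l (>⇒∤ (<-trans (n<1+n l) k<p)) (>⇒∤ k<p) φ′ ortho φ′≢φ
... | inj₂ min≡k⁻¹ rewrite min≡k⁻¹ = at-inverse k⁻¹ (proj₁ least) (least-inverse< p {k} least)
  where
  1%p≡1 : 1 % p ≡ 1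
  1%p≡1 = m<n⇒m%n≡m (<-trans 2≤k k<p)
  at-inverse : ∀ j → IsInverseMod p k j → j < p → log[ j ] p +1≤ distance (linear p k) φ′
  -- The inverse 0 would give `0 ≡ 1`, and the inverse 1 would give `k ≡ 1`, both impossible for
  -- `2 ≤ k < p`. Hence `j − 1` is positive, and neither it nor `j` is divisible by `p`.
  at-inverse 0 inv _ = contradiction
    (trans (sym 1%p≡1) (trans (sym inv) (trans (cong (_% p) (*-zeroʳ k)) (m<n⇒m%n≡m (≤-<-trans z≤n k<p))))) λ ()
  at-inverse 1 inv _ = contradiction
    (trans (sym (trans (cong (_% p) (*-identityʳ k)) (m<n⇒m%n≡m k<p))) (trans inv 1%p≡1)) λ ()
  at-inverse (suc i@(suc _)) inv j<p =
    Residues.distance-inverse-multiplier p p-prime l (>⇒∤ (<-trans (n<1+n l) k<p)) (>⇒∤ k<p) φ′ ortho φ′≢φ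
      i (>⇒∤ (<-trans (n<1+n i) j<p)) (>⇒∤ j<p) (Residues.inverse-≈ p {k} {suc i} inv)
theorem6p1 p _ _ 1 (s≤s ())
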